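{- Let $n=p^k$, where $p$ is an odd prime and $k>2$ is an integer, and let $G=\langle p^{k-1}-1\rangle$ be the subgroup of $\mathbb{Z}_n^\times$ generated by $p^{k-1}-1$. Then the coset index function $f_G$ is a $\left(p^k,\frac{2p^{k-1}-p^{k-2}+1}{2},\{1,p,p^k-p^{k-1}+1\}\right)$ zero-difference function.
   Context: For a subgroup $G$ of $\mathbb{Z}_n^\times$ and $r\in\mathbb{Z}_n$, the coset $rG=\{rg\mid g\in G\}$; these cosets partition $\mathbb{Z}_n$, forming a set $D_G$. The coset index function induced by $G$ is $f_G:\mathbb{Z}_n\to\mathbb{Z}_{|D_G|}$, $f_G(x)=h_G(C_x)$, where $C_x$ is the coset containing $x$ and $h_G:D_G\to\mathbb{Z}_{|D_G|}$ is a fixed bijection. A function $f:A\to B$ between finite abelian groups is an $(n,m,S)$ zero-difference function if $n=|A|$, $m=|f(A)|$, and for every nonzero $a\in A$, $|\{x\in A\mid f(x+a)=f(x)\}|\in S$. Here $A=(\mathbb{Z}_n,+)$. -}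

module Defs where

open import Level using (Level; _⊔_; 0ℓ) renaming (suc to lsuc)
open import Algebra.Bundles using (Group; AbelianGroup; CommutativeRing)
open import Algebra.Definitions using (Invertible)
import Algebra.Properties.CommutativeSemigroup as CommutativeSemigroupProperties
open import Data.Fin.Properties as Fin using ()
open import Data.Integer.Base using (ℤ; +_; _+_; _-_; _*_; -_; 0ℤ; 1ℤ)
open import Data.Integer.Divisibility.Signed
  using (_∣_; divides; ∣m∣n⇒∣m+n; ∣m⇒∣-m; ∣m⇒∣m*n; ∣n⇒∣m*n)
import Data.Integer.Properties as ℤ
open import Data.Integer.Tactic.RingSolver using (solve-∀)
open import Data.Nat.Base as ℕ using (ℕ; _^_; _∸_; _<_)
import Data.Nat.Properties as ℕ
open import Data.Product.Base using (Σ; ∃; _×_; _,_; proj₁; proj₂)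
open import Function.Bundles using (Func; Bijection)
open import Relation.Binary.Bundles using (Setoid)
import Relation.Binary.Construct.On as On
open import Relation.Binary.Definitions using (_Respects_)
open import Relation.Binary.PropositionalEquality as ≡ using (_≡_)
import Relation.Binary.Reasoning.Setoid as SetoidReasoning
open import Relation.Nullary.Negation using (¬_)
open import Relation.Unary using (Pred; _∈_; _≐_)
open import Relation.Unary.Relation.Binary.Equality using (≐-setoid)

private variable
  a b c ℓ ℓ₁ ℓ₂ p s : Level

-- Quotients and subsets are setoids throughout, so cardinality is a bijection
-- up to the setoid's equality.
HasCardinality : Setoid a ℓ → ℕ → Set (a ⊔ ℓ)
HasCardinality S n = Bijection S (Fin.≡-setoid n)

-- Witnesses of P are ignored by the equality, so elements are not counted twice.
Subset : (S : Setoid a ℓ) → Pred (Setoid.Carrier S) p → Setoid (a ⊔ p) ℓ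
Subset S P = On.setoid S (proj₁ {B = P})

Image : {S : Setoid a ℓ₁} {T : Setoid b ℓ₂} → Func S T → Setoid (a ⊔ b ⊔ ℓ₂) ℓ₂
Image {T = T} f = Subset T λ y → ∃ λ x → Func.to f x ≈ y
  where open Setoid T

record IsZeroDifference
  (A : AbelianGroup a ℓ₁) (B : AbelianGroup b ℓ₂)
  (f : Func (AbelianGroup.setoid A) (AbelianGroup.setoid B))
  (n m : ℕ) (S : Pred ℕ s) : Set (a ⊔ b ⊔ ℓ₁ ⊔ ℓ₂ ⊔ s) where
  private
    module A = AbelianGroup A
    module B = AbelianGroup B
    module f = Func f
  field
    domain-cardinality : HasCardinality A.setoid n
    codomain-finite    : ∃ λ r → HasCardinality B.setoid r
    image-cardinality  : HasCardinality (Image f) m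
    zero-difference    : ∀ a → ¬ (a A.≈ A.ε) → ∃ λ t → t ∈ S ×
      HasCardinality (Subset A.setoid λ x → f.to (x A.∙ a) B.≈ f.to x) t

record Subgroup (𝒢 : Group c ℓ) p : Set (c ⊔ ℓ ⊔ lsuc p) where
  open Group 𝒢
  field
    Member    : Pred Carrier p
    resp      : Member Respects _≈_
    ε-closed  : Member ε
    ∙-closed  : ∀ {x y} → Member x → Member y → Member (x ∙ y)
    ⁻¹-closed : ∀ {x} → Member x → Member (x ⁻¹)

module _ (𝒢 : Group c ℓ) where
  open Group 𝒢 using (Carrier; _≈_; _∙_; ε; _⁻¹)

  -- The least subgroup containing g.
  data Generated (g : Carrier) : Pred Carrier (c ⊔ ℓ) where
    generator : Generated g g
    resp      : ∀ {x y} → x ≈ y → Generated g x → Generated g y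
    identity  : Generated g ε
    product   : ∀ {x y} → Generated g x → Generated g y → Generated g (x ∙ y)
    inverse   : ∀ {x} → Generated g x → Generated g (x ⁻¹)

⟨_⟩ : {𝒢 : Group c ℓ} → Group.Carrier 𝒢 → Subgroup 𝒢 (c ⊔ ℓ)
⟨_⟩ {𝒢 = 𝒢} g = record
  { Member    = Generated 𝒢 g
  ; resp      = resp
  ; ε-closed  = identity
  ; ∙-closed  = product
  ; ⁻¹-closed = inverse
  }

module _ (R : CommutativeRing c ℓ) where
  open CommutativeRing R
    using (Carrier; _≈_; 1#; refl; sym; trans; setoid; *-cong; *-congˡ; *-congʳ;
           *-assoc; *-comm; *-identityˡ; *-identityʳ; *-commutativeSemigroup)
    renaming (_*_ to _·_)
  open CommutativeSemigroupProperties *-commutativeSemigroup using (interchange)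
  open SetoidReasoning setoid

  private
    Unit : Set (c ⊔ ℓ)
    Unit = Σ Carrier (Invertible _≈_ 1# _·_)

    mul : Unit → Unit → Unit
    mul (x , x′ , x′x , xx′) (y , y′ , y′y , yy′) =
      x · y , x′ · y′ ,
      trans (interchange x′ y′ x y) (trans (*-cong x′x y′y) (*-identityˡ 1#)) ,
      trans (interchange x y x′ y′) (trans (*-cong xx′ yy′) (*-identityˡ 1#))

    inv : Unit → Unit
    inv (x , x′ , x′x , xx′) = x′ , x , xx′ , x′x

    inv-cong : ∀ u v → proj₁ u ≈ proj₁ v → proj₁ (inv u) ≈ proj₁ (inv v)
    inv-cong (x , x′ , x′x , xx′) (y , y′ , y′y , yy′) x≈y = begin
      x′            ≈⟨ *-identityʳ x′ ⟨
      x′ · 1#       ≈⟨ *-congˡ yy′ ⟨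
      x′ · (y · y′) ≈⟨ *-assoc x′ y y′ ⟨
      (x′ · y) · y′ ≈⟨ *-congʳ (*-congˡ x≈y) ⟨
      (x′ · x) · y′ ≈⟨ *-congʳ x′x ⟩
      1# · y′       ≈⟨ *-identityˡ y′ ⟩
      y′            ∎

  _ˣ : Group (c ⊔ ℓ) ℓ
  _ˣ = record
    { Carrier = Unit
    -- The inverse and its proofs do not take part in equality of units.
    ; _≈_     = λ u v → proj₁ u ≈ proj₁ v
    ; _∙_     = mul
    ; ε       = 1# , 1# , *-identityˡ 1# , *-identityˡ 1#
    ; _⁻¹     = inv
    ; isGroup = record
      { isMonoid = record
        { isSemigroup = record
          { isMagma = record
            { isEquivalence = On.isEquivalence proj₁ (Setoid.isEquivalence setoid)
            ; ∙-cong        = *-cong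
            }
          ; assoc = λ u v w → *-assoc (proj₁ u) (proj₁ v) (proj₁ w)
          }
        ; identity = (λ u → *-identityˡ (proj₁ u)) , (λ u → *-identityʳ (proj₁ u))
        }
      ; inverse = (λ u → proj₁ (proj₂ (proj₂ u))) , (λ u → proj₂ (proj₂ (proj₂ u)))
      ; ⁻¹-cong = λ {u} {v} → inv-cong u v
      }
    }

infix 4 _≡_[mod_]

record _≡_[mod_] (x y : ℤ) (n : ℕ) : Set where
  constructor mod
  field n∣x-y : + n ∣ x - y

open _≡_[mod_] public

private
  via : ∀ {n x y z} → z ≡ x - y → + n ∣ z → x ≡ y [mod n ]
  via {n} eq d = mod (≡.subst (+ n ∣_) eq d)

  ≡⇒mod : ∀ {n x y} → x ≡ y → x ≡ y [mod n ]
  ≡⇒mod {n} {x} ≡.refl = mod (divides 0ℤ (ℤ.+-inverseʳ x))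

  mod-sym : ∀ {n x y} → x ≡ y [mod n ] → y ≡ x [mod n ]
  mod-sym {n} {x} {y} (mod d) = via (lemma x y) (∣m⇒∣-m d)
    where
    lemma : ∀ x y → - (x - y) ≡ y - x
    lemma = solve-∀

  mod-trans : ∀ {n x y z} → x ≡ y [mod n ] → y ≡ z [mod n ] → x ≡ z [mod n ]
  mod-trans {n} {x} {y} {z} (mod d) (mod e) = via (lemma x y z) (∣m∣n⇒∣m+n d e)
    where
    lemma : ∀ x y z → (x - y) + (y - z) ≡ x - z
    lemma = solve-∀

  +-cong : ∀ {n x y u v} → x ≡ y [mod n ] → u ≡ v [mod n ] → x + u ≡ y + v [mod n ]
  +-cong {n} {x} {y} {u} {v} (mod d) (mod e) = via (lemma x y u v) (∣m∣n⇒∣m+n d e)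
    where
    lemma : ∀ x y u v → (x - y) + (u - v) ≡ (x + u) - (y + v)
    lemma = solve-∀

  neg-cong : ∀ {n x y} → x ≡ y [mod n ] → - x ≡ - y [mod n ]
  neg-cong {n} {x} {y} (mod d) = via (lemma x y) (∣m⇒∣-m d)
    where
    lemma : ∀ x y → - (x - y) ≡ (- x) - (- y)
    lemma = solve-∀

  *-cong : ∀ {n x y u v} → x ≡ y [mod n ] → u ≡ v [mod n ] → x * u ≡ y * v [mod n ]
  *-cong {n} {x} {y} {u} {v} (mod d) (mod e) =
    via (lemma x y u v) (∣m∣n⇒∣m+n (∣m⇒∣m*n u d) (∣n⇒∣m*n y e))
    where
    lemma : ∀ x y u v → (x - y) * u + y * (u - v) ≡ x * u - y * v
    lemma = solve-∀

ℤ/ : ℕ → CommutativeRing 0ℓ 0ℓ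
ℤ/ n = record
  { Carrier = ℤ
  ; _≈_     = _≡_[mod n ]
  ; _+_     = _+_
  ; _*_     = _*_
  ; -_      = -_
  ; 0#      = 0ℤ
  ; 1#      = 1ℤ
  ; isCommutativeRing = record
    { isRing = record
      { +-isAbelianGroup = record
        { isGroup = record
          { isMonoid = record
            { isSemigroup = record
              { isMagma = record
                { isEquivalence = record
                  { refl  = ≡⇒mod ≡.refl
                  ; sym   = mod-sym
                  ; trans = mod-trans
                  }
                ; ∙-cong = +-cong
                }
              ; assoc = λ x y z → ≡⇒mod (ℤ.+-assoc x y z)
              }
            ; identity = (λ x → ≡⇒mod (ℤ.+-identityˡ x)) , (λ x → ≡⇒mod (ℤ.+-identityʳ x))
            }
          ; inverse = (λ x → ≡⇒mod (ℤ.+-inverseˡ x)) , (λ x → ≡⇒mod (ℤ.+-inverseʳ x))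
          ; ⁻¹-cong = neg-cong
          }
        ; comm = λ x y → ≡⇒mod (ℤ.+-comm x y)
        }
      ; *-cong     = *-cong
      ; *-assoc    = λ x y z → ≡⇒mod (ℤ.*-assoc x y z)
      ; *-identity = (λ x → ≡⇒mod (ℤ.*-identityˡ x)) , (λ x → ≡⇒mod (ℤ.*-identityʳ x))
      ; distrib    = (λ x y z → ≡⇒mod (ℤ.*-distribˡ-+ x y z))
                   , (λ x y z → ≡⇒mod (ℤ.*-distribʳ-+ x y z))
      }
    ; *-comm = λ x y → ≡⇒mod (ℤ.*-comm x y)
    }
  }

ℤ/⁺ : ℕ → AbelianGroup 0ℓ 0ℓ
ℤ/⁺ n = CommutativeRing.+-abelianGroup (ℤ/ n)

module _ {n : ℕ} (G : Subgroup (ℤ/ n ˣ) 0ℓ) where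
  open CommutativeRing (ℤ/ n) using (_≈_; setoid; sym; trans; *-congʳ; *-congˡ)
  open Subgroup G
  open SetoidReasoning setoid
  private module U = Group (ℤ/ n ˣ)

  coset : ℤ → Pred ℤ 0ℓ
  coset r x = ∃ λ g → g ∈ Member × x ≈ r * proj₁ g

  -- The set D_G of those subsets of ℤ/n that are cosets, under equality of
  -- subsets.
  Cosets : Setoid (lsuc 0ℓ) 0ℓ
  Cosets = Subset (≐-setoid ℤ 0ℓ) λ C → ∃ λ r → C ≐ coset r

  ∈-coset : ∀ x → x ∈ coset x
  ∈-coset x = U.ε , ε-closed , ≡⇒mod (≡.sym (ℤ.*-identityʳ x))

  private
    coset-⊆ : ∀ r s → r ∈ coset s → ∀ {y} → y ∈ coset r → y ∈ coset s
    coset-⊆ r s (g , g∈ , r≈sg) {y} (h , h∈ , y≈rh) =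
      g U.∙ h , ∙-closed g∈ h∈ , (begin
        y                         ≈⟨ y≈rh ⟩
        r * proj₁ h               ≈⟨ *-congʳ r≈sg ⟩
        s * proj₁ g * proj₁ h     ≡⟨ ℤ.*-assoc s (proj₁ g) (proj₁ h) ⟩
        s * (proj₁ g * proj₁ h)   ∎)

    coset-sym : ∀ r s → r ∈ coset s → s ∈ coset r
    coset-sym r s (g , g∈ , r≈sg) = g U.⁻¹ , ⁻¹-closed g∈ , (begin
      s                              ≡⟨ ℤ.*-identityʳ s ⟨
      s * 1ℤ                         ≈⟨ *-congˡ {s} (U.inverseʳ g) ⟨
      s * (proj₁ g * proj₁ (g U.⁻¹)) ≡⟨ ℤ.*-assoc s (proj₁ g) (proj₁ (g U.⁻¹)) ⟨
      s * proj₁ g * proj₁ (g U.⁻¹)   ≈⟨ *-congʳ r≈sg ⟨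
      r * proj₁ (g U.⁻¹)             ∎)

  coset-unique : ∀ r x → x ∈ coset r → coset r ≐ coset x
  coset-unique r x x∈ = coset-⊆ r x (coset-sym x r x∈) , coset-⊆ x r x∈

  -- By ∈-coset and coset-unique, coset x is the one coset containing x.
  cosetOf : Func setoid Cosets
  cosetOf = record
    { to   = λ x → coset x , x , (λ z → z) , (λ z → z)
    ; cong = λ {x} {y} x≈y → coset-unique x y
        (U.ε , ε-closed , trans (sym x≈y) (≡⇒mod (≡.sym (ℤ.*-identityʳ x))))
    }

  -- h is the chosen numbering h_G of D_G by ℤ/d, where d is to be |D_G|.
  cosetIndex : ∀ {d} → Bijection Cosets (CommutativeRing.setoid (ℤ/ d)) →
               Func setoid (CommutativeRing.setoid (ℤ/ d))
  cosetIndex h = record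
    { to   = λ x → h.to (cosetOf.to x)
    ; cong = λ x≈y → h.cong (cosetOf.cong x≈y)
    }
    where
    module h = Bijection h
    module cosetOf = Func cosetOf

private
  square-vanishes : ∀ p k → 2 < k → + (p ^ k) ∣ + (p ^ (k ∸ 1)) * + (p ^ (k ∸ 1))
  square-vanishes p k@(ℕ.suc j@(ℕ.suc i)) _ = divides (+ (p ^ i)) (begin
    + (p ^ j) * + (p ^ j) ≡⟨ ℤ.pos-* (p ^ j) (p ^ j) ⟨
    + (p ^ j ℕ.* p ^ j)   ≡⟨ ≡.cong +_ (ℕ.^-distribˡ-+-* p j j) ⟨
    + (p ^ (j ℕ.+ j))     ≡⟨ ≡.cong (λ e → + (p ^ e)) (ℕ.+-suc i j) ⟨
    + (p ^ (i ℕ.+ k))     ≡⟨ ≡.cong +_ (ℕ.^-distribˡ-+-* p i k) ⟩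
    + (p ^ i ℕ.* p ^ k)   ≡⟨ ℤ.pos-* (p ^ i) (p ^ k) ⟩
    + (p ^ i) * + (p ^ k) ∎)
    where open ≡.≡-Reasoning
  square-vanishes p 1 (ℕ.s≤s ())

-- Its inverse is - p ^ (k - 1) - 1, since p ^ k divides p ^ (2 (k - 1)).
p^[k-1]-1 : ∀ p k → 2 < k → Group.Carrier (ℤ/ (p ^ k) ˣ)
p^[k-1]-1 p k 2<k = q - 1ℤ , - q - 1ℤ , mod (pf lemma₁) , mod (pf lemma₂)
  where
  q : ℤ
  q = + (p ^ (k ∸ 1))

  lemma₁ : ∀ q → - (q * q) ≡ (- q - 1ℤ) * (q - 1ℤ) - 1ℤ
  lemma₁ = solve-∀

  lemma₂ : ∀ q → - (q * q) ≡ (q - 1ℤ) * (- q - 1ℤ) - 1ℤ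
  lemma₂ = solve-∀

  pf : ∀ {z : ℤ → ℤ} → (∀ q → - (q * q) ≡ z q) → + (p ^ k) ∣ z q
  pf eq = ≡.subst (+ (p ^ k) ∣_) (eq q) (∣m⇒∣-m (square-vanishes p k 2<k))

{-# OPTIONS --safe #-}
module Submission where

-- Put q = p^(k-1), n = p q. As q² = 0 in ℤ/n, the powers of q - 1 are the units
-- ±1 + jq. Hence y and x lie in one coset iff x ≡ ±y modulo n, or p ∤ y and
-- x ≡ ±y modulo q. The cosets are then counted by explicit representatives.
-- For a ≠ 0 the x with f(x + a) = f(x) satisfy 2x ≡ -a modulo n or q (solvable
-- uniquely, as n is odd), unless q ∣ a, when every x prime to p qualifies too.

open import Algebra.Bundles using (AbelianGroup; CommutativeRing; Group)
open import Data.Empty using (⊥-elim)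
open import Data.Fin.Base using (Fin; toℕ; fromℕ<)
import Data.Fin.Properties as Fin
open import Data.Integer.Base as ℤ using (ℤ; +_; -[1+_]; 0ℤ; 1ℤ; -1ℤ)
import Data.Integer.Divisibility.Signed as ℤ
import Data.Integer.DivMod as ℤ
import Data.Integer.Properties as ℤ
open import Data.Integer.Tactic.RingSolver using (solve-∀)
open import Data.List.Base using ([]; _∷_)
open import Data.List.Membership.Propositional using (_∈_)
open import Data.List.Relation.Unary.Any using (here; there)
open import Data.Nat.Base as ℕ using (ℕ; suc; NonZero)
import Data.Nat.Coprimality as ℕ
import Data.Nat.Divisibility as ℕ
import Data.Nat.DivMod as ℕ
open import Data.Nat.GCD using (module Bézout)
import Data.Nat.Primality as ℕ
import Data.Nat.Properties as ℕ
import Data.Nat.Tactic.RingSolver as ℕ-Solver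
open import Data.Product.Base using (∃; _×_; _,_; proj₁; proj₂)
open import Data.Sum.Base as Sum using (_⊎_; inj₁; inj₂)
open import Data.Sum.Function.Propositional using (_⊎-↔_)
open import Defs
open import Function.Base using (_∘_)
open import Function.Bundles using (Bijection; Func; Inverse; _↔_)
open import Function.Construct.Composition using () renaming (bijection to Bijection-trans)
open import Function.Construct.Identity using (↔-id)
open import Function.Construct.Symmetry using () renaming (bijection to Bijection-sym)
open import Function.Properties.Inverse using (↔-trans)
open import Level using (0ℓ)
open import Relation.Binary.Bundles using (Setoid)
open import Relation.Binary.PropositionalEquality
  using (_≡_; refl; sym; trans; cong; cong₂; subst; subst₂)
open import Relation.Nullary.Decidable using (Dec; yes; no)
open import Relation.Nullary.Negation using (¬_; contradiction)

-- Setoid cardinalities and generated subgroups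

-- The bijection sends `x` to the index that `e-surjective` picks for it; injectivity of `e` makes
-- this choice respect the equality of `S`.
enumerate : ∀ {a b ℓ} {S : Setoid a ℓ} {I : Set b} {t} → Fin t ↔ I →
  (e : I → Setoid.Carrier S) →
  (∀ {i j} → Setoid._≈_ S (e i) (e j) → i ≡ j) →
  (∀ x → ∃ λ i → Setoid._≈_ S (e i) x) →
  HasCardinality S t
enumerate {S = S} ι e e-injective e-surjective = record
  { to        = ι.from ∘ index
  ; cong      = λ {x} {y} x≈y → cong ι.from (e-injective
      (S.trans (e-index x) (S.trans x≈y (S.sym (e-index y)))))
  ; bijective =
      (λ {x} {y} eq → S.trans (S.sym (e-index x))
        (S.trans (S.reflexive (cong e (from-injective eq))) (e-index y)))
    , (λ i → e (ι.to i) , λ {z} z≈ →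
        trans (cong ι.from (e-injective (S.trans (e-index z) z≈))) (ι.strictlyInverseʳ i))
  }
  where
  module S = Setoid S
  module ι = Inverse ι

  index : S.Carrier → _
  index x = proj₁ (e-surjective x)

  e-index : ∀ x → e (index x) S.≈ x
  e-index x = proj₂ (e-surjective x)

  from-injective : ∀ {i j} → ι.from i ≡ ι.from j → i ≡ j
  from-injective {i} {j} eq =
    trans (sym (ι.strictlyInverseˡ i)) (trans (cong ι.to eq) (ι.strictlyInverseˡ j))

-- Equality in `Subset` looks at the underlying element alone, so membership proofs can be exchanged
-- while congruence and injectivity carry over.
Subset-cardinality : ∀ {a ℓ p q} {S : Setoid a ℓ}
  {P : Setoid.Carrier S → Set p} {Q : Setoid.Carrier S → Set q} →
  (∀ x → P x → Q x) → (∀ x → Q x → P x) →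
  ∀ {t} → HasCardinality (Subset S P) t → HasCardinality (Subset S Q) t
Subset-cardinality P⇒Q Q⇒P β = record
  { to        = λ (x , Qx) → β.to (x , Q⇒P x Qx)
  ; cong      = β.cong
  ; bijective = β.injective , λ i → let (x , Px) , eq = β.surjective i in (x , P⇒Q x Px) , eq
  }
  where module β = Bijection β

-- Leastness of the generated subgroup; it serves to bound `⟨ g ⟩` from above by the units ±1 modulo
-- `q`.
generated-induction : ∀ {c ℓ s} {𝒢 : Group c ℓ} {g} (P : Group.Carrier 𝒢 → Set s) →
  P g →
  (∀ {x y} → Group._≈_ 𝒢 x y → P x → P y) →
  P (Group.ε 𝒢) →
  (∀ {x y} → P x → P y → P (Group._∙_ 𝒢 x y)) →
  (∀ {x} → P x → P (Group._⁻¹ 𝒢 x)) →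
  ∀ {x} → Generated 𝒢 g x → P x
generated-induction P Pg P-resp Pε P∙ P⁻¹ = go
  where
  go : ∀ {x} → Generated _ _ x → P x
  go generator     = Pg
  go (resp x≈y x∈) = P-resp x≈y (go x∈)
  go identity      = Pε
  go (product x y) = P∙ (go x) (go y)
  go (inverse x)   = P⁻¹ (go x)

-- Odd numbers

-- Oddness carries its half as data: the half bounds the residues taken up to sign, enters an
-- exponent, and solves `2x ≡ -a`.
Odd : ℕ → Set
Odd n = ∃ λ m → n ≡ suc (m ℕ.+ m)

odd-* : ∀ {m n} → Odd m → Odd n → Odd (m ℕ.* n)
odd-* (a , refl) (b , refl) = a ℕ.+ b ℕ.+ (a ℕ.+ a) ℕ.* b , lemma a b
  where
  lemma : ∀ a b → suc (a ℕ.+ a) ℕ.* suc (b ℕ.+ b) ≡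
    suc ((a ℕ.+ b ℕ.+ (a ℕ.+ a) ℕ.* b) ℕ.+ (a ℕ.+ b ℕ.+ (a ℕ.+ a) ℕ.* b))
  lemma = ℕ-Solver.solve-∀

odd-^ : ∀ {n} k → Odd n → Odd (n ℕ.^ k)
odd-^ 0       _ = 0 , refl
odd-^ (suc k) o = odd-* o (odd-^ k o)

¬2∣⇒odd : ∀ {n} → ¬ (2 ℕ.∣ n) → Odd n
¬2∣⇒odd {n} ¬2∣n with n ℕ.% 2 in eq | ℕ.m%n<n n 2 | ℕ.m≡m%n+[m/n]*n n 2
... | 0           | _                     | _  = contradiction (ℕ.m%n≡0⇒n∣m n 2 eq) ¬2∣n
... | 1           | _                     | n≡ = n ℕ./ 2 , trans n≡ (cong suc (lemma (n ℕ./ 2)))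
  where
  lemma : ∀ x → x ℕ.* 2 ≡ x ℕ.+ x
  lemma = ℕ-Solver.solve-∀
... | suc (suc _) | ℕ.s≤s (ℕ.s≤s ())      | _

odd⇒nonZero : ∀ {n} → Odd n → NonZero n
odd⇒nonZero (_ , refl) = _

subst-toℕ : ∀ {m n} (m≡n : m ≡ n) (i : Fin m) → toℕ (subst Fin m≡n i) ≡ toℕ i
subst-toℕ refl i = refl

-- Residues, signs and digits of integers

module Congruences where
  open import Data.Integer.Base using (_+_; _-_; _*_; -_)
  open import Data.Integer.Divisibility.Signed using (_∣_; divides)

  -- Turns a divisibility into a single identity for the ring solver.
  ∣-combination : ∀ {d a b x} u v → d ∣ a → d ∣ b → x ≡ u * a + v * b → d ∣ x
  ∣-combination u v d∣a d∣b refl = ℤ.∣m∣n⇒∣m+n (ℤ.∣n⇒∣m*n u d∣a) (ℤ.∣n⇒∣m*n v d∣b)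

  ∣-small : ∀ {n x} → + n ∣ x → ℤ.∣ x ∣ ℕ.< n → x ≡ 0ℤ
  ∣-small {n} {x} n∣x ∣x∣<n with ℤ.∣ x ∣ in eq | ℤ.∣⇒∣ᵤ n∣x
  ... | 0     | _ = ℤ.∣i∣≡0⇒i≡0 eq
  ... | suc _ | d = contradiction d (ℕ.>⇒∤ ∣x∣<n)

  -- If `d = 1 + 2m`, then `y = y d - m (2y)`.
  ∣-halve : ∀ {d y} → Odd d → + d ∣ y + y → + d ∣ y
  ∣-halve {d} {y} (m , d≡) d∣2y = ∣-combination y (- + m) ℤ.∣-refl d∣2y
    (trans (lemma (+ m) y) (cong (λ z → y * z + - + m * (y + y)) (sym (cong +_ d≡))))
    where
    lemma : ∀ m y → y ≡ y * (1ℤ + (m + m)) + - m * (y + y)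
    lemma = solve-∀

  residue : ∀ n .{{_ : NonZero n}} x → ∃ λ (i : Fin n) → + n ∣ x - + toℕ i
  residue n x = fromℕ< (ℤ.n%ℕd<d x n) , divides (x ℤ./ℕ n)
    (trans (cong₂ (λ y i → y - + i) (ℤ.a≡a%ℕn+[a/ℕn]*n x n) (Fin.toℕ-fromℕ< (ℤ.n%ℕd<d x n)))
      (lemma (+ (x ℤ.%ℕ n)) ((x ℤ./ℕ n) * + n)))
    where
    lemma : ∀ r s → (r + s) - r ≡ s
    lemma = solve-∀

  -- `|i - j|` is at most the maximum of `i` and `j`, hence below `n`, and 0 is the only such
  -- multiple of `n`.
  small-difference : ∀ {n i j} → i ℕ.< n → j ℕ.< n → + n ∣ + i - + j → i ≡ j
  small-difference {n} {i} {j} i<n j<n n∣ = ℤ.+-injective (ℤ.i-j≡0⇒i≡j (+ i) (+ j)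
    (∣-small n∣ (ℕ.≤-<-trans
      (subst (ℕ._≤ i ℕ.⊔ j) (cong ℤ.∣_∣ (sym (ℤ.[+m]-[+n]≡m⊖n i j))) (ℤ.∣m⊝n∣≤m⊔n i j))
      (ℕ.⊔-lub i<n j<n))))

  residue-unique : ∀ {n} {i j : Fin n} → + n ∣ + toℕ i - + toℕ j → i ≡ j
  residue-unique {i = i} {j} n∣ =
    Fin.toℕ-injective (small-difference (Fin.toℕ<n i) (Fin.toℕ<n j) n∣)

  infix 4 _≡±_[mod_]

  _≡±_[mod_] : ℤ → ℤ → ℕ → Set
  x ≡± y [mod n ] = + n ∣ x - y ⊎ + n ∣ x + y

  ≡±-sym : ∀ {n} x y → x ≡± y [mod n ] → y ≡± x [mod n ]
  ≡±-sym x y (inj₁ d) = inj₁ (subst (_ ∣_) (lemma x y) (ℤ.∣m⇒∣-m d))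
    where
    lemma : ∀ x y → - (x - y) ≡ y - x
    lemma = solve-∀
  ≡±-sym x y (inj₂ d) = inj₂ (subst (_ ∣_) (ℤ.+-comm x y) d)

  ≡±-∣ : ∀ {n} x y → x ≡± y [mod n ] → + n ∣ x → + n ∣ y
  ≡±-∣ x y (inj₁ d) n∣x = ∣-combination -1ℤ 1ℤ d n∣x (lemma x y)
    where
    lemma : ∀ x y → y ≡ -1ℤ * (x - y) + 1ℤ * x
    lemma = solve-∀
  ≡±-∣ x y (inj₂ d) n∣x = ∣-combination 1ℤ -1ℤ d n∣x (lemma x y)
    where
    lemma : ∀ x y → y ≡ 1ℤ * (x + y) + -1ℤ * x
    lemma = solve-∀

  ≡±-weaken : ∀ {m n x y} → + m ∣ + n → x ≡± y [mod n ] → x ≡± y [mod m ]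
  ≡±-weaken m∣n = Sum.map (ℤ.∣-trans m∣n) (ℤ.∣-trans m∣n)

  ≡±-scale : ∀ {d n x y} k → + n ∣ + d * k → x ≡± y [mod d ] → k * x ≡± k * y [mod n ]
  ≡±-scale {d} {n} {x} {y} k n∣dk (inj₁ (divides s eq)) = inj₁
    (subst (+ n ∣_) (trans (lemma (+ d) k s) (trans (cong (k *_) (sym eq)) (lemma′ k x y)))
      (ℤ.∣n⇒∣m*n s n∣dk))
    where
    lemma : ∀ d k s → s * (d * k) ≡ k * (s * d)
    lemma = solve-∀
    lemma′ : ∀ k x y → k * (x - y) ≡ k * x - k * y
    lemma′ = solve-∀
  ≡±-scale {d} {n} {x} {y} k n∣dk (inj₂ (divides s eq)) = inj₂
    (subst (+ n ∣_) (trans (lemma (+ d) k s) (trans (cong (k *_) (sym eq)) (lemma′ k x y)))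
      (ℤ.∣n⇒∣m*n s n∣dk))
    where
    lemma : ∀ d k s → s * (d * k) ≡ k * (s * d)
    lemma = solve-∀
    lemma′ : ∀ k x y → k * (x + y) ≡ k * x + k * y
    lemma′ = solve-∀

  -- The numbers 0, ..., `m` represent the residues modulo `2m + 1` up to sign: since `i + j ≤ 2m`,
  -- a minus sign forces `i = j = 0`.
  fold-unique : ∀ {m i j} → i ℕ.≤ m → j ℕ.≤ m → + i ≡± + j [mod suc (m ℕ.+ m) ] → i ≡ j
  fold-unique {m} i≤m j≤m (inj₁ d) =
    small-difference (ℕ.s≤s (ℕ.m≤n⇒m≤n+o m i≤m)) (ℕ.s≤s (ℕ.m≤n⇒m≤n+o m j≤m)) d
  fold-unique {m} {i} {j} i≤m j≤m (inj₂ d) =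
    trans (ℕ.m+n≡0⇒m≡0 i i+j≡0) (sym (ℕ.m+n≡0⇒n≡0 i i+j≡0))
    where
    i+j≡0 : i ℕ.+ j ≡ 0
    i+j≡0 = ℤ.+-injective (∣-small d (ℕ.s≤s (ℕ.+-mono-≤ i≤m j≤m)))

  fold : ∀ m x → ∃ λ (i : Fin (suc m)) → x ≡± + toℕ i [mod suc (m ℕ.+ m) ]
  fold m x with residue (suc (m ℕ.+ m)) x
  ... | r , d with toℕ r ℕ.≤? m
  ...   | yes r≤m = fromℕ< (ℕ.s≤s r≤m) ,
    inj₁ (subst (λ i → + suc (m ℕ.+ m) ∣ x - + i) (sym (Fin.toℕ-fromℕ< (ℕ.s≤s r≤m))) d)
  -- A residue above `m` is replaced by `n - r ≤ m`, and `x + (n - r) = (x - r) + n`.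
  ...   | no  r≰m = fromℕ< (ℕ.s≤s s≤m) ,
    inj₂ (subst (λ i → + n ∣ x + + i) (sym (Fin.toℕ-fromℕ< (ℕ.s≤s s≤m)))
      (∣-combination 1ℤ 1ℤ d ℤ.∣-refl
        (trans (cong (λ z → x + z) +s≡) (lemma x (+ n) (+ toℕ r)))))
    where
    n = suc (m ℕ.+ m)
    s = n ℕ.∸ toℕ r
    s≤m : s ℕ.≤ m
    s≤m = subst (s ℕ.≤_) (ℕ.m+n∸m≡n m m) (ℕ.∸-monoʳ-≤ n (ℕ.≰⇒> r≰m))
    +s≡ : + s ≡ + n - + toℕ r
    +s≡ = trans (sym (ℤ.⊖-≥ (ℕ.<⇒≤ (Fin.toℕ<n r)))) (sym (ℤ.[+m]-[+n]≡m⊖n n (toℕ r)))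
    lemma : ∀ x n r → x + (n - r) ≡ 1ℤ * (x - r) + 1ℤ * n
    lemma = solve-∀

  -- Writing `x = i + s p`, the class of `x` modulo `n = p e` depends only on `s` modulo `e`; `t` is
  -- the residue of `s`.
  digit : ∀ {n} p e .{{_ : NonZero e}} → n ≡ p ℕ.* e → ∀ x i → + p ∣ x - i →
    ∃ λ (t : Fin e) → + n ∣ x - (i + + p * + toℕ t)
  digit {n} p e n≡ x i (divides s eq) with residue e s
  ... | t , divides z eq′ = t , divides z
    (trans (lemma x i (+ p) (+ toℕ t))
    (trans (cong (_- + p * + toℕ t) eq)
    (trans (lemma′ s (+ p) (+ toℕ t))
    (trans (cong (+ p *_) eq′)
    (trans (lemma″ (+ p) z (+ e))
    (cong (z *_) (sym (trans (cong +_ n≡) (ℤ.pos-* p e)))))))))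
    where
    lemma : ∀ x i p t → x - (i + p * t) ≡ (x - i) - p * t
    lemma = solve-∀
    lemma′ : ∀ s p t → s * p - p * t ≡ p * (s - t)
    lemma′ = solve-∀
    lemma″ : ∀ p z e → p * (z * e) ≡ z * (p * e)
    lemma″ = solve-∀

  digit-unique : ∀ {n} p e .{{_ : NonZero p}} → n ≡ p ℕ.* e → ∀ i {t u : Fin e} →
    + n ∣ (i + + p * + toℕ t) - (i + + p * + toℕ u) → t ≡ u
  digit-unique p e n≡ i {t} {u} n∣ = residue-unique (ℤ.*-cancelˡ-∣ (+ p)
    (subst₂ _∣_ (trans (cong +_ n≡) (ℤ.pos-* p e)) (lemma i (+ p) (+ toℕ t) (+ toℕ u)) n∣))
    where
    lemma : ∀ i p t u → (i + p * t) - (i + p * u) ≡ p * (t - u)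
    lemma = solve-∀

  inverse-mod-prime : ∀ {p} → ℕ.Prime p → ∀ y → ¬ (+ p ∣ y) → ∃ λ w → + p ∣ y * w - 1ℤ
  inverse-mod-prime {p} p-prime y p∤y with residue p {{ℕ.prime⇒nonZero p-prime}} y
  ... | i , d = invert (ℕ.coprime-Bézout (ℕ.prime⇒coprime p-prime {{ℕ.≢-nonZero c≢0}} (Fin.toℕ<n i)))
    where
    c = toℕ i

    c≢0 : ¬ c ≡ 0
    c≢0 c≡0 = p∤y (subst (+ p ∣_) (trans (cong (λ c → y - + c) c≡0) (ℤ.+-identityʳ y)) d)

    combine : ∀ y c w → y * w - 1ℤ ≡ w * (y - c) + 1ℤ * (c * w - 1ℤ)
    combine = solve-∀

    +-equation : ∀ a b x y → 1 ℕ.+ a ℕ.* b ≡ x ℕ.* y → 1ℤ + + a * + b ≡ + x * + y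
    +-equation a b x y eq =
      trans (cong (λ z → 1ℤ + z) (sym (ℤ.pos-* a b))) (trans (cong +_ eq) (ℤ.pos-* x y))

    -- From `1 + v c = u p` the inverse of `c` is `-v`; from `1 + u p = v c` it is `v`.
    invert : Bézout.Identity 1 p c → ∃ λ w → + p ∣ y * w - 1ℤ
    invert (Bézout.+- u v eq) = - + v , ∣-combination (- + v) 1ℤ d
      (divides (- + u) (trans (lemma (+ c) (+ v))
        (trans (cong -_ (+-equation v c u p eq)) (ℤ.neg-distribˡ-* (+ u) (+ p)))))
      (combine y (+ c) (- + v))
      where
      lemma : ∀ c v → c * - v - 1ℤ ≡ - (1ℤ + v * c)
      lemma = solve-∀
    invert (Bézout.-+ u v eq) = + v , ∣-combination (+ v) 1ℤ d
      (divides (+ u) (trans (cong (_- 1ℤ)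
        (trans (ℤ.*-comm (+ c) (+ v)) (sym (+-equation u p v c eq)))) (lemma (+ u * + p))))
      (combine y (+ c) (+ v))
      where
      lemma : ∀ x → 1ℤ + x - 1ℤ ≡ x
      lemma = solve-∀

  ≡±1-* : ∀ {n} x y → x ≡± 1ℤ [mod n ] → y ≡± 1ℤ [mod n ] → x * y ≡± 1ℤ [mod n ]
  ≡±1-* x y (inj₁ a) (inj₁ b) = inj₁ (∣-combination y 1ℤ a b (lemma x y))
    where
    lemma : ∀ x y → x * y - 1ℤ ≡ y * (x - 1ℤ) + 1ℤ * (y - 1ℤ)
    lemma = solve-∀
  ≡±1-* x y (inj₁ a) (inj₂ b) = inj₂ (∣-combination y 1ℤ a b (lemma x y))
    where
    lemma : ∀ x y → x * y + 1ℤ ≡ y * (x - 1ℤ) + 1ℤ * (y + 1ℤ)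
    lemma = solve-∀
  ≡±1-* x y (inj₂ a) (inj₁ b) = inj₂ (∣-combination y -1ℤ a b (lemma x y))
    where
    lemma : ∀ x y → x * y + 1ℤ ≡ y * (x + 1ℤ) + -1ℤ * (y - 1ℤ)
    lemma = solve-∀
  ≡±1-* x y (inj₂ a) (inj₂ b) = inj₁ (∣-combination y -1ℤ a b (lemma x y))
    where
    lemma : ∀ x y → x * y - 1ℤ ≡ y * (x + 1ℤ) + -1ℤ * (y + 1ℤ)
    lemma = solve-∀

  ≡±1-resp : ∀ {n} x y → + n ∣ x - y → x ≡± 1ℤ [mod n ] → y ≡± 1ℤ [mod n ]
  ≡±1-resp x y d (inj₁ e) = inj₁ (∣-combination 1ℤ -1ℤ e d (lemma x y))
    where
    lemma : ∀ u v → v - 1ℤ ≡ 1ℤ * (u - 1ℤ) + -1ℤ * (u - v)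
    lemma = solve-∀
  ≡±1-resp x y d (inj₂ e) = inj₂ (∣-combination 1ℤ -1ℤ e d (lemma x y))
    where
    lemma : ∀ u v → v + 1ℤ ≡ 1ℤ * (u + 1ℤ) + -1ℤ * (u - v)
    lemma = solve-∀

  ≡±1-inverse : ∀ {n} x y → + n ∣ x * y - 1ℤ → x ≡± 1ℤ [mod n ] → y ≡± 1ℤ [mod n ]
  ≡±1-inverse x y d (inj₁ e) = inj₁ (∣-combination (- y) 1ℤ e d (lemma x y))
    where
    lemma : ∀ x y → y - 1ℤ ≡ - y * (x - 1ℤ) + 1ℤ * (x * y - 1ℤ)
    lemma = solve-∀
  ≡±1-inverse x y d (inj₂ e) = inj₂ (∣-combination y -1ℤ e d (lemma x y))
    where
    lemma : ∀ x y → y + 1ℤ ≡ y * (x + 1ℤ) + -1ℤ * (x * y - 1ℤ)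
    lemma = solve-∀

  ≡±-cancel : ∀ {n e} k .{{_ : NonZero k}} → n ≡ k ℕ.* e → ∀ x y →
    + k * x ≡± + k * y [mod n ] → x ≡± y [mod e ]
  ≡±-cancel {e = e} k n≡ x y (inj₁ d) = inj₁ (ℤ.*-cancelˡ-∣ (+ k)
    (subst₂ _∣_ (trans (cong +_ n≡) (ℤ.pos-* k e)) (lemma (+ k) x y) d))
    where
    lemma : ∀ k x y → k * x - k * y ≡ k * (x - y)
    lemma = solve-∀
  ≡±-cancel {e = e} k n≡ x y (inj₂ d) = inj₂ (ℤ.*-cancelˡ-∣ (+ k)
    (subst₂ _∣_ (trans (cong +_ n≡) (ℤ.pos-* k e)) (lemma (+ k) x y) d))
    where
    lemma : ∀ k x y → k * x + k * y ≡ k * (x + y)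
    lemma = solve-∀

  ≡±-reduce : ∀ n x y s t → x + + n * s ≡± y + + n * t [mod n ] → x ≡± y [mod n ]
  ≡±-reduce n x y s t (inj₁ d) = inj₁ (∣-combination 1ℤ (t - s) d ℤ.∣-refl (lemma x y s t (+ n)))
    where
    lemma : ∀ x y s t n → x - y ≡ 1ℤ * ((x + n * s) - (y + n * t)) + (t - s) * n
    lemma = solve-∀
  ≡±-reduce n x y s t (inj₂ d) = inj₂ (∣-combination 1ℤ (- (s + t)) d ℤ.∣-refl (lemma x y s t (+ n)))
    where
    lemma : ∀ x y s t n → x + y ≡ 1ℤ * ((x + n * s) + (y + n * t)) + - (s + t) * n
    lemma = solve-∀

-- Only n = p² r with p and r odd matters; for n = p ^ k, r is p ^ (k - 2).
module SquareFactor
  (p q r n : ℕ) (q≡p*r : q ≡ p ℕ.* r) (n≡p*q : n ≡ p ℕ.* q)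
  (p-prime : ℕ.Prime p) (p-odd : Odd p) (r-odd : Odd r) where

  open import Data.Integer.Base using (_+_; _-_; _*_; -_)
  open import Data.Integer.Divisibility.Signed using (_∣_; divides)
  open Congruences

  -- Divisibility among p, q and n

  q-odd : Odd q
  q-odd = subst Odd (sym q≡p*r) (odd-* p-odd r-odd)

  n-odd : Odd n
  n-odd = subst Odd (sym n≡p*q) (odd-* p-odd q-odd)

  instance
    p≢0 : NonZero p
    p≢0 = odd⇒nonZero p-odd
    r≢0 : NonZero r
    r≢0 = odd⇒nonZero r-odd
    q≢0 : NonZero q
    q≢0 = odd⇒nonZero q-odd
    n≢0 : NonZero n
    n≢0 = odd⇒nonZero n-odd

  +n≡p*q : + n ≡ + p * + q
  +n≡p*q = trans (cong +_ n≡p*q) (ℤ.pos-* p q)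

  q∣n : + q ∣ + n
  q∣n = divides (+ p) +n≡p*q

  p∣q : + p ∣ + q
  p∣q = divides (+ r) (trans (cong +_ q≡p*r) (trans (ℤ.pos-* p r) (ℤ.*-comm (+ p) (+ r))))

  p∣n : + p ∣ + n
  p∣n = ℤ.∣-trans p∣q q∣n

  p∣x∧q∣y⇒n∣x*y : ∀ {x y} → + p ∣ x → + q ∣ y → + n ∣ x * y
  p∣x∧q∣y⇒n∣x*y (divides s refl) (divides t refl) =
    divides (s * t) (trans (lemma s t (+ p) (+ q)) (cong (λ z → s * t * z) (sym +n≡p*q)))
    where
    lemma : ∀ s t p q → (s * p) * (t * q) ≡ s * t * (p * q)
    lemma = solve-∀

  n∣q*q : + n ∣ + q * + q
  n∣q*q = p∣x∧q∣y⇒n∣x*y p∣q ℤ.∣-refl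

  -- The relation that describes the cosets

  infix 4 _∼_

  -- The condition on `y` holds for `x` as well: `x ≡ ±y` modulo `q`, a multiple of `p`, makes `p`
  -- divide both or neither.
  _∼_ : ℤ → ℤ → Set
  x ∼ y = x ≡± y [mod n ] ⊎ (¬ (+ p ∣ y) × x ≡± y [mod q ])

  ∼⇒≡±[q] : ∀ {x y} → x ∼ y → x ≡± y [mod q ]
  ∼⇒≡±[q] {x} {y} (inj₁ x≡±y)     = ≡±-weaken {x = x} {y} q∣n x≡±y
  ∼⇒≡±[q]         (inj₂ (_ , x≡±y)) = x≡±y

  ∼⇒≡±[p] : ∀ {x y} → x ∼ y → x ≡± y [mod p ]
  ∼⇒≡±[p] {x} {y} x∼y = ≡±-weaken {x = x} {y} p∣q (∼⇒≡±[q] {x} {y} x∼y)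

  -- The upper bound for the subgroup generated by `q - 1`, which is -1 modulo `q`. The lower bound
  -- is given by `1+sq∈G` and `-[1+sq]∈G`.
  ±1 : Subgroup (ℤ/ n ˣ) 0ℓ
  ±1 = record
    { Member    = λ u → proj₁ u ≡± 1ℤ [mod q ]
    ; resp      = λ {u} {v} (mod d) → ≡±1-resp (proj₁ u) (proj₁ v) (ℤ.∣-trans q∣n d)
    ; ε-closed  = inj₁ (divides 0ℤ refl)
    ; ∙-closed  = λ {u} {v} → ≡±1-* (proj₁ u) (proj₁ v)
    ; ⁻¹-closed = λ { {x , x′ , _ , mod d} → ≡±1-inverse x x′ (ℤ.∣-trans q∣n d) }
    }

  ≡q-1⇒∈±1 : ∀ u → proj₁ u ≡ + q - 1ℤ → Subgroup.Member ±1 u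
  ≡q-1⇒∈±1 u u≡ = inj₂ (divides 1ℤ (trans (cong (_+ 1ℤ) u≡) (lemma (+ q))))
    where
    lemma : ∀ q → q - 1ℤ + 1ℤ ≡ 1ℤ * q
    lemma = solve-∀

  -- G is a parameter, not ⟨ g ⟩, because comparing two elaborations of the
  -- ambient group of ⟨ g ⟩ by conversion is infeasible.
  module UnitSubgroup (G : Subgroup (ℤ/ n ˣ) 0ℓ)
    (g : Group.Carrier (ℤ/ n ˣ)) (g≡ : proj₁ g ≡ + q - 1ℤ) (g∈G : Subgroup.Member G g)
    (G⊆±1 : ∀ {u} → Subgroup.Member G u → Subgroup.Member ±1 u) where

    open Group (ℤ/ n ˣ) using () renaming (Carrier to Unit)
    private module G = Subgroup G

    -- The inverse is `1 - s q`, since `(1 + s q) (1 - s q) = 1 - s² q²` and `q²` vanishes modulo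
    -- `n`.
    1+_·q : ℤ → Unit
    1+ s ·q = 1ℤ + s * + q , 1ℤ - s * + q ,
      mod (subst (+ n ∣_) (lemma₁ s (+ q)) (ℤ.∣n⇒∣m*n (- (s * s)) n∣q*q)) ,
      mod (subst (+ n ∣_) (lemma₂ s (+ q)) (ℤ.∣n⇒∣m*n (- (s * s)) n∣q*q))
      where
      lemma₁ : ∀ s q → - (s * s) * (q * q) ≡ (1ℤ - s * q) * (1ℤ + s * q) - 1ℤ
      lemma₁ = solve-∀
      lemma₂ : ∀ s q → - (s * s) * (q * q) ≡ (1ℤ + s * q) * (1ℤ - s * q) - 1ℤ
      lemma₂ = solve-∀

    negate : Unit → Unit
    negate (x , x′ , mod d , mod e) = - x , - x′ ,
      mod (subst (+ n ∣_) (lemma x′ x) d) , mod (subst (+ n ∣_) (lemma x x′) e)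
      where
      lemma : ∀ x y → x * y - 1ℤ ≡ - x * - y - 1ℤ
      lemma = solve-∀

    -- As `q²` vanishes, `s ↦ 1 + s q` turns sums into products; powers of such a unit are therefore
    -- multiples of `s`.
    member-+ : ∀ s t → G.Member (1+ s ·q) → G.Member (1+ t ·q) → G.Member (1+ s + t ·q)
    member-+ s t a b =
      G.resp (mod (subst (+ n ∣_) (lemma s t (+ q)) (ℤ.∣n⇒∣m*n (s * t) n∣q*q))) (G.∙-closed a b)
      where
      lemma : ∀ s t q → s * t * (q * q) ≡ (1ℤ + s * q) * (1ℤ + t * q) - (1ℤ + (s + t) * q)
      lemma = solve-∀

    member-+* : ∀ s → G.Member (1+ s ·q) → ∀ j → G.Member (1+ + j * s ·q)
    member-+* s a 0       = G.resp (mod (divides 0ℤ refl)) G.ε-closed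
    member-+* s a (suc j) = subst (λ t → G.Member (1+ t ·q)) (sym (ℤ.suc-* (+ j) s))
      (member-+ s (+ j * s) a (member-+* s a j))

    member-* : ∀ s → G.Member (1+ s ·q) → ∀ z → G.Member (1+ z * s ·q)
    member-* s a (+ j)    = member-+* s a j
    member-* s a -[1+ j ] =
      G.resp (mod (divides 0ℤ (lemma (+ suc j) s (+ q)))) (G.⁻¹-closed (member-+* s a (suc j)))
      where
      lemma : ∀ z s q → (1ℤ - z * s * q) - (1ℤ + - z * s * q) ≡ 0ℤ
      lemma = solve-∀

    -- Squaring removes the sign: `(q - 1)² = 1 - 2q + q²`.
    member-g² : G.Member (1+ - (1ℤ + 1ℤ) ·q)
    member-g² = G.resp (mod (subst (+ n ∣_)
      (trans (lemma (+ q)) (cong (λ x → x * x - (1ℤ + - (1ℤ + 1ℤ) * + q)) (sym g≡))) n∣q*q))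
      (G.∙-closed g∈G g∈G)
      where
      lemma : ∀ q → q * q ≡ (q - 1ℤ) * (q - 1ℤ) - (1ℤ + - (1ℤ + 1ℤ) * q)
      lemma = solve-∀

    -- With p = 1 + 2m, g² = 1 - 2q is raised to the power ms, and
    -- -2ms = s - ps.
    1+sq∈G : ∀ s → G.Member (1+ s ·q)
    1+sq∈G s = G.resp (mod (divides (- s)
      (trans (lemma s (+ m) (+ q)) (cong (λ z → - s * z)
        (sym (trans +n≡p*q (cong (λ z → + z * + q) p≡)))))))
      (member-* (- (1ℤ + 1ℤ)) member-g² (s * + m))
      where
      m  = proj₁ p-odd
      p≡ = proj₂ p-odd
      lemma : ∀ s m q → (1ℤ + s * m * - (1ℤ + 1ℤ) * q) - (1ℤ + s * q) ≡ - s * ((1ℤ + (m + m)) * q)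
      lemma = solve-∀

    -- In `(q - 1) (1 + (1 + s) q)` the extra `q` cancels the `q` of the first factor, leaving
    -- `-(1 + s q)` up to a multiple of `q²`.
    -[1+sq]∈G : ∀ s → G.Member (negate (1+ s ·q))
    -[1+sq]∈G s = G.resp (mod (subst (+ n ∣_)
      (trans (lemma s (+ q)) (cong (λ x → x * (1ℤ + (1ℤ + s) * + q) - - (1ℤ + s * + q)) (sym g≡)))
      (ℤ.∣n⇒∣m*n (1ℤ + s) n∣q*q)))
      (G.∙-closed g∈G (1+sq∈G (1ℤ + s)))
      where
      lemma : ∀ s q → (1ℤ + s) * (q * q) ≡ (q - 1ℤ) * (1ℤ + (1ℤ + s) * q) - - (1ℤ + s * q)
      lemma = solve-∀

    -- If `x ≡ y u` with `q ∣ u ∓ 1`, then `x ∓ y` is `y (u ∓ 1)` modulo `n`. A factor `p` in `y`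
    -- lifts divisibility by `q` to divisibility by `n = p q`; without it only `q` remains.
    ∈coset⇒∼ : ∀ {x y} → coset G y x → x ∼ y
    ∈coset⇒∼ {x} {y} ((u , _) , u∈G , mod d) with G⊆±1 u∈G | + p ℤ.∣? y
    ... | inj₁ e | yes p∣y = inj₁ (inj₁ (∣-combination 1ℤ 1ℤ d (p∣x∧q∣y⇒n∣x*y p∣y e) (lemma x y u)))
      where
      lemma : ∀ x y u → x - y ≡ 1ℤ * (x - y * u) + 1ℤ * (y * (u - 1ℤ))
      lemma = solve-∀
    ... | inj₁ e | no  p∤y = inj₂ (p∤y , inj₁ (∣-combination 1ℤ y (ℤ.∣-trans q∣n d) e (lemma x y u)))
      where
      lemma : ∀ x y u → x - y ≡ 1ℤ * (x - y * u) + y * (u - 1ℤ)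
      lemma = solve-∀
    ... | inj₂ e | yes p∣y = inj₁ (inj₂ (∣-combination 1ℤ 1ℤ d (p∣x∧q∣y⇒n∣x*y p∣y e) (lemma x y u)))
      where
      lemma : ∀ x y u → x + y ≡ 1ℤ * (x - y * u) + 1ℤ * (y * (u + 1ℤ))
      lemma = solve-∀
    ... | inj₂ e | no  p∤y = inj₂ (p∤y , inj₂ (∣-combination 1ℤ y (ℤ.∣-trans q∣n d) e (lemma x y u)))
      where
      lemma : ∀ x y u → x + y ≡ 1ℤ * (x - y * u) + y * (u + 1ℤ)
      lemma = solve-∀

    -- If y w = 1 + z p, then y (1 + s w q) ≡ y + s q modulo n = p q.
    ∼⇒∈coset : ∀ {x y} → x ∼ y → coset G y x
    ∼⇒∈coset {x} {y} (inj₁ (inj₁ d)) = 1+ 0ℤ ·q , 1+sq∈G 0ℤ ,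
      mod (subst (+ n ∣_) (cong (λ z → x - z) (sym (ℤ.*-identityʳ y))) d)
    ∼⇒∈coset {x} {y} (inj₁ (inj₂ d)) = negate (1+ 0ℤ ·q) , -[1+sq]∈G 0ℤ ,
      mod (subst (+ n ∣_) (lemma x y) d)
      where
      lemma : ∀ x y → x + y ≡ x - y * -1ℤ
      lemma = solve-∀
    ∼⇒∈coset {x} {y} (inj₂ (p∤y , inj₁ (divides s eq))) =
      let w , d = inverse-mod-prime p-prime y p∤y in
      1+ s * w ·q , 1+sq∈G (s * w) ,
      mod (subst (+ n ∣_)
        (trans (lemma y w s (+ q)) (trans (cong (_- y * (s * w * + q)) (sym eq))
          (lemma′ x y (s * w * + q))))
        (p∣x∧q∣y⇒n∣x*y {y * w - 1ℤ} { - s * + q} d (ℤ.∣n⇒∣m*n (- s) ℤ.∣-refl)))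
      where
      lemma : ∀ y w s q → (y * w - 1ℤ) * (- s * q) ≡ s * q - y * (s * w * q)
      lemma = solve-∀
      lemma′ : ∀ x y t → (x - y) - y * t ≡ x - y * (1ℤ + t)
      lemma′ = solve-∀
    ∼⇒∈coset {x} {y} (inj₂ (p∤y , inj₂ (divides s eq))) =
      let w , d = inverse-mod-prime p-prime y p∤y in
      negate (1+ - s * w ·q) , -[1+sq]∈G (- s * w) ,
      mod (subst (+ n ∣_)
        (trans (lemma y w s (+ q)) (trans (cong (_+ y * (- s * w * + q)) (sym eq))
          (lemma′ x y (- s * w * + q))))
        (p∣x∧q∣y⇒n∣x*y {y * w - 1ℤ} { - s * + q} d (ℤ.∣n⇒∣m*n (- s) ℤ.∣-refl)))
      where
      lemma : ∀ y w s q → (y * w - 1ℤ) * (- s * q) ≡ s * q + y * (- s * w * q)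
      lemma = solve-∀
      lemma′ : ∀ x y t → (x + y) + y * t ≡ x - y * - (1ℤ + t)
      lemma′ = solve-∀

  -- Representatives of the cosets

  ∤-small : ∀ {b} → suc b ℕ.< p → ¬ (+ p ∣ + suc b)
  ∤-small b<p p∣b = ℕ.>⇒∤ b<p (ℤ.∣⇒∣ᵤ p∣b)

  p∣c+p*t⇒p∣c : ∀ c t → + p ∣ c + + p * t → + p ∣ c
  p∣c+p*t⇒p∣c c t d = ∣-combination 1ℤ (- t) d ℤ.∣-refl (lemma c (+ p) t)
    where
    lemma : ∀ c p t → c ≡ 1ℤ * (c + p * t) + - t * p
    lemma = solve-∀

  first-digit-unique : ∀ {b c} → b ℕ.< p → c ℕ.< p → ∀ t s →
    + p ∣ (+ b + + p * t) - (+ c + + p * s) → b ≡ c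
  first-digit-unique {b} {c} b<p c<p t s d = small-difference b<p c<p
    (∣-combination 1ℤ (s - t) d ℤ.∣-refl (lemma (+ b) (+ c) t s (+ p)))
    where
    lemma : ∀ b c t s p → b - c ≡ 1ℤ * ((b + p * t) - (c + p * s)) + (s - t) * p
    lemma = solve-∀

  -- `p = 1 + 2m` and `q = 1 + 2M`.
  m M : ℕ
  m = proj₁ p-odd
  M = proj₁ q-odd

  -- A multiple `p i` is determined modulo `n` by `i` modulo `q`, which up to sign leaves 0, ...,
  -- `M`. A residue modulo `q` prime to `p` has, up to sign, a first digit in 1, ..., `m` and any of
  -- `r` second digits.
  Representative : Set
  Representative = Fin (suc M) ⊎ (Fin m × Fin r)

  -- Multiples of p are paired off with their negatives modulo n, the other
  -- residues modulo q; the latter are normalised by their residue modulo p.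
  representative : Representative → ℤ
  representative (inj₁ i)       = + p * + toℕ i
  representative (inj₂ (b , t)) = + suc (toℕ b) + + p * + toℕ t

  suc-b<p : ∀ (b : Fin m) → suc (toℕ b) ℕ.< p
  suc-b<p b = subst (suc (toℕ b) ℕ.<_) (sym (proj₂ p-odd))
    (ℕ.s≤s (ℕ.m≤n⇒m≤n+o m (Fin.toℕ<n b)))

  p∤representative : ∀ b t → ¬ (+ p ∣ representative (inj₂ (b , t)))
  p∤representative b t = ∤-small (suc-b<p b) ∘ p∣c+p*t⇒p∣c (+ suc (toℕ b)) (+ toℕ t)

  p∣p*i : ∀ i → + p ∣ + p * i
  p∣p*i i = ℤ.∣m⇒∣m*n i ℤ.∣-refl

  representative-injective : ∀ u v → representative u ∼ representative v → u ≡ v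
  representative-injective (inj₁ i) (inj₁ j) (inj₁ e) =
    cong inj₁ (Fin.toℕ-injective (fold-unique (ℕ.≤-pred (Fin.toℕ<n i)) (ℕ.≤-pred (Fin.toℕ<n j))
      (subst (+ toℕ i ≡± + toℕ j [mod_]) (proj₂ q-odd)
        (≡±-cancel p n≡p*q (+ toℕ i) (+ toℕ j) e))))
  representative-injective (inj₁ i) (inj₁ j) (inj₂ (p∤ , _)) = contradiction (p∣p*i (+ toℕ j)) p∤
  representative-injective u@(inj₁ i) v@(inj₂ (b , t)) u∼v = contradiction
    (≡±-∣ (representative u) (representative v)
      (∼⇒≡±[p] {representative u} {representative v} u∼v) (p∣p*i (+ toℕ i)))
    (p∤representative b t)
  representative-injective u@(inj₂ (b , t)) v@(inj₁ j) u∼v = contradiction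
    (≡±-∣ (representative v) (representative u)
      (≡±-sym (representative u) (representative v)
        (∼⇒≡±[p] {representative u} {representative v} u∼v)) (p∣p*i (+ toℕ j)))
    (p∤representative b t)
  -- Modulo `p` only the first digits survive, and both lie in 1, ..., `m`.
  representative-injective u@(inj₂ (b , t)) v@(inj₂ (c , s)) u∼v
    with Fin.toℕ-injective {i = b} {c} (ℕ.suc-injective (fold-unique (Fin.toℕ<n b) (Fin.toℕ<n c)
      (subst (+ suc (toℕ b) ≡± + suc (toℕ c) [mod_]) (proj₂ p-odd)
        (≡±-reduce p (+ suc (toℕ b)) (+ suc (toℕ c)) (+ toℕ t) (+ toℕ s)
          (∼⇒≡±[p] {representative u} {representative v} u∼v)))))
  ... | refl with ∼⇒≡±[q] {representative u} {representative v} u∼v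
  ...   | inj₁ d = cong (λ t → inj₂ (b , t)) (digit-unique p r q≡p*r (+ suc (toℕ b)) d)
  -- A minus sign would make `p` divide twice the common first digit, which lies strictly between 0
  -- and `p`.
  ...   | inj₂ d = contradiction
    (∣-halve p-odd (p∣c+p*t⇒p∣c (+ suc (toℕ b) + + suc (toℕ b)) (+ toℕ t + + toℕ s)
      (subst (+ p ∣_) (lemma (+ suc (toℕ b)) (+ p) (+ toℕ t) (+ toℕ s)) (ℤ.∣-trans p∣q d))))
    (∤-small (suc-b<p b))
    where
    lemma : ∀ c p t s → (c + p * t) + (c + p * s) ≡ (c + c) + p * (t + s)
    lemma = solve-∀

  representative-surjective : ∀ x → ∃ λ u → representative u ∼ x
  representative-surjective x with + p ℤ.∣? x
  -- For `x = s p`, the cofactor `s` is folded modulo `q` and the result scaled by `p`.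
  ... | yes (divides s eq) = inj₁ (proj₁ (fold M s)) ,
    inj₁ (≡±-sym x (+ p * i)
      (subst (_≡± + p * i [mod n ]) (trans (ℤ.*-comm (+ p) s) (sym eq))
        (≡±-scale {x = s} {i} (+ p) (ℤ.∣-reflexive (trans +n≡p*q (ℤ.*-comm (+ p) (+ q))))
          (subst (s ≡± i [mod_]) (sym (proj₂ q-odd)) (proj₂ (fold M s))))))
    where
    i = + toℕ (proj₁ (fold M s))
  ... | no p∤x with fold m x
  ...   | Fin.zero , x≡±0 = contradiction
    (≡±-∣ 0ℤ x (≡±-sym x 0ℤ (subst (x ≡± 0ℤ [mod_]) (sym (proj₂ p-odd)) x≡±0))
      (divides 0ℤ refl)) p∤x
  ...   | Fin.suc b , x≡±c with subst (x ≡± + suc (toℕ b) [mod_]) (sym (proj₂ p-odd)) x≡±c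
  ...     | inj₁ d =
    let t , e = digit p r q≡p*r x (+ suc (toℕ b)) d in
    inj₂ (b , t) , inj₂ (p∤x , ≡±-sym x (representative (inj₂ (b , t))) (inj₁ e))
  -- When `x` is minus the first digit modulo `p`, it is `-x` that gets expanded.
  ...     | inj₂ d =
    let t , e = digit p r q≡p*r (- x) (+ suc (toℕ b))
                  (subst (+ p ∣_) (lemma x (+ suc (toℕ b))) (ℤ.∣m⇒∣-m d)) in
    inj₂ (b , t) , inj₂ (p∤x , inj₂
      (subst (+ q ∣_) (lemma′ x (representative (inj₂ (b , t)))) (ℤ.∣m⇒∣-m e)))
    where
    lemma : ∀ x c → - (x + c) ≡ - x - c
    lemma = solve-∀
    lemma′ : ∀ x y → - (- x - y) ≡ y + x
    lemma′ = solve-∀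

  -- Coincidences under a shift by a

  open Setoid (AbelianGroup.setoid (ℤ/⁺ n)) using () renaming (sym to mod-sym)

  module _ (a : ℤ) where
    -- Since n = 1 + 2h, the solution of 2x ≡ -a modulo n is a h.
    x₀ : ℤ
    x₀ = a * + proj₁ n-odd

    n∣[x₀+a]+x₀ : + n ∣ (x₀ + a) + x₀
    n∣[x₀+a]+x₀ = divides a (trans (lemma a (+ proj₁ n-odd))
      (cong (λ n → a * + n) (sym (proj₂ n-odd))))
      where
      lemma : ∀ a h → (a * h + a) + a * h ≡ a * (1ℤ + (h + h))
      lemma = solve-∀

    -- Two solutions of `2x ≡ -a` differ by some `z` with `2z ≡ 0`, and an odd modulus allows
    -- halving.
    ∣x-x₀ : ∀ {d} x → Odd d → + d ∣ + n → + d ∣ (x + a) + x → + d ∣ x - x₀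
    ∣x-x₀ x d-odd d∣n e = ∣-halve d-odd
      (∣-combination 1ℤ -1ℤ e (ℤ.∣-trans d∣n n∣[x₀+a]+x₀) (lemma x a x₀))
      where
      lemma : ∀ x a y → (x - y) + (x - y) ≡ 1ℤ * ((x + a) + x) + -1ℤ * ((y + a) + y)
      lemma = solve-∀

    ∣[x+a]+x : ∀ {d} x → + d ∣ + n → + d ∣ x - x₀ → + d ∣ (x + a) + x
    ∣[x+a]+x x d∣n e =
      ∣-combination (1ℤ + 1ℤ) 1ℤ e (ℤ.∣-trans d∣n n∣[x₀+a]+x₀) (lemma x a x₀)
      where
      lemma : ∀ x a y → (x + a) + x ≡ (1ℤ + 1ℤ) * (x - y) + 1ℤ * ((y + a) + y)
      lemma = solve-∀

    ∣[x+a]-x⇒∣a : ∀ {d} x → d ∣ (x + a) - x → d ∣ a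
    ∣[x+a]-x⇒∣a x = subst (_ ∣_) (lemma x a)
      where
      lemma : ∀ x a → (x + a) - x ≡ a
      lemma = solve-∀

    ∣a⇒∣[x+a]-x : ∀ {d} x → d ∣ a → d ∣ (x + a) - x
    ∣a⇒∣[x+a]-x x = subst (_ ∣_) (lemma x a)
      where
      lemma : ∀ x a → a ≡ (x + a) - x
      lemma = solve-∀

    -- Phrased with `∼` so that counting is independent of the numbering of the cosets;
    -- `Subset-cardinality` translates later.
    Coincidences : Setoid 0ℓ 0ℓ
    Coincidences = Subset (AbelianGroup.setoid (ℤ/⁺ n)) λ x → x + a ∼ x

    count : ∀ {I : Set} {t} → Fin t ↔ I → (e : I → ℤ) →
      (∀ i → e i + a ∼ e i) →
      (∀ i j → + n ∣ e i - e j → i ≡ j) →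
      (∀ x → x + a ∼ x → ∃ λ i → + n ∣ x - e i) →
      HasCardinality Coincidences t
    count ι e e-∼ e-injective e-surjective = enumerate ι
      (λ i → e i , e-∼ i)
      (λ {i} {j} (mod d) → e-injective i j d)
      (λ (x , x+a∼x) → let i , d = e-surjective x x+a∼x in
        i , mod-sym {x} {e i} (mod d))

    x₀-∼ : x₀ + a ∼ x₀
    x₀-∼ = inj₁ (inj₂ n∣[x₀+a]+x₀)

    -- All `(p - 1) q` residues prime to `p` qualify, as `x + a ≡ x` modulo `q`. A multiple of `p`
    -- must satisfy `x + a ≡ ±x` modulo `n`; plus would give `n ∣ a`, and minus leaves `x₀`, which
    -- is a multiple of `p` because `a` is.
    count-q∣a : + q ∣ a → ¬ (+ n ∣ a) → HasCardinality Coincidences (ℕ.pred p ℕ.* q ℕ.+ 1)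
    count-q∣a q∣a n∤a = count
      (↔-trans Fin.+↔⊎ (Fin.*↔× ⊎-↔ ↔-id _)) e e-∼ e-injective e-surjective
      where
      e : (Fin (ℕ.pred p) × Fin q) ⊎ Fin 1 → ℤ
      e (inj₁ (b , t)) = + suc (toℕ b) + + p * + toℕ t
      e (inj₂ _)       = x₀

      suc-b<p′ : ∀ (b : Fin (ℕ.pred p)) → suc (toℕ b) ℕ.< p
      suc-b<p′ b = subst (suc (toℕ b) ℕ.<_) (ℕ.suc-pred p) (ℕ.s≤s (Fin.toℕ<n b))

      p∤e : ∀ b t → ¬ (+ p ∣ e (inj₁ (b , t)))
      p∤e b t = ∤-small (suc-b<p′ b) ∘ p∣c+p*t⇒p∣c (+ suc (toℕ b)) (+ toℕ t)

      p∣x₀ : + p ∣ x₀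
      p∣x₀ = ℤ.∣m⇒∣m*n (+ proj₁ n-odd) (ℤ.∣-trans p∣q q∣a)

      e-∼ : ∀ i → e i + a ∼ e i
      e-∼ i@(inj₁ (b , t)) = inj₂ (p∤e b t , inj₁ (∣a⇒∣[x+a]-x (e i) q∣a))
      e-∼ (inj₂ _)         = x₀-∼

      same-digit : ∀ b t c s → + n ∣ e (inj₁ (b , t)) - e (inj₁ (c , s)) → b ≡ c
      same-digit b t c s d = Fin.toℕ-injective (ℕ.suc-injective
        (first-digit-unique (suc-b<p′ b) (suc-b<p′ c) (+ toℕ t) (+ toℕ s) (ℤ.∣-trans p∣n d)))

      n∤e-x₀ : ∀ b t → ¬ (e (inj₁ (b , t)) ≡± x₀ [mod n ])
      n∤e-x₀ b t e≡±x₀ = p∤e b t (≡±-∣ x₀ (e (inj₁ (b , t)))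
        (≡±-sym (e (inj₁ (b , t))) x₀ (≡±-weaken {x = e (inj₁ (b , t))} {x₀} p∣n e≡±x₀)) p∣x₀)

      pair-unique : ∀ {b c} → b ≡ c → ∀ t s →
        + n ∣ e (inj₁ (b , t)) - e (inj₁ (c , s)) → (b , t) ≡ (c , s)
      pair-unique {b} refl t s d =
        cong (b ,_) (digit-unique p q n≡p*q (+ suc (toℕ b)) d)

      e-injective : ∀ i j → + n ∣ e i - e j → i ≡ j
      e-injective (inj₁ (b , t)) (inj₁ (c , s)) d =
        cong inj₁ (pair-unique (same-digit b t c s d) t s d)
      e-injective (inj₁ (b , t)) (inj₂ _) d = ⊥-elim (n∤e-x₀ b t (inj₁ d))
      e-injective (inj₂ _) (inj₁ (b , t)) d =
        ⊥-elim (n∤e-x₀ b t (≡±-sym x₀ (e (inj₁ (b , t))) (inj₁ d)))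
      e-injective (inj₂ Fin.zero) (inj₂ Fin.zero) _ = refl

      e-surjective : ∀ x → x + a ∼ x → ∃ λ i → + n ∣ x - e i
      e-surjective x x+a∼x with + p ℤ.∣? x | residue p x
      -- The residue is viewed in `Fin (suc (pred p))` so that matching separates 0 from the
      -- admissible first digits.
      ... | no p∤x | i , d with subst Fin (sym (ℕ.suc-pred p)) i
                     | subst-toℕ (sym (ℕ.suc-pred p)) i
      ...   | Fin.zero  | i≡ = contradiction
        (subst (+ p ∣_) (trans (cong (λ i → x - + i) (sym i≡)) (ℤ.+-identityʳ x)) d) p∤x
      ...   | Fin.suc b | i≡ =
        let t , z = digit p q n≡p*q x (+ suc (toℕ b))
                      (subst (λ i → + p ∣ x - + i) (sym i≡) d) in
        inj₁ (b , t) , z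
      e-surjective x (inj₁ (inj₁ d)) | yes _ | _ = contradiction (∣[x+a]-x⇒∣a x d) n∤a
      e-surjective x (inj₁ (inj₂ d)) | yes _ | _ = inj₂ Fin.zero , ∣x-x₀ x n-odd ℤ.∣-refl d
      e-surjective x (inj₂ (p∤x , _)) | yes p∣x | _ = contradiction p∣x p∤x

    -- A plus sign would give `q ∣ a`. A minus sign modulo `q` gives `p ∣ 2x`, hence `p ∣ x`, so the
    -- alternative for `x` prime to `p` is void and only `x₀` is left.
    count-p∣a : ¬ (+ q ∣ a) → + p ∣ a → HasCardinality Coincidences 1
    count-p∣a q∤a p∣a = count (↔-id _) (λ _ → x₀) (λ _ → x₀-∼)
      (λ { Fin.zero Fin.zero _ → refl ; (Fin.suc ()) _ _ ; _ (Fin.suc ()) _ })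
      (λ x x+a∼x → Fin.zero , surjective x x+a∼x)
      where
      surjective : ∀ x → x + a ∼ x → + n ∣ x - x₀
      surjective x (inj₁ (inj₁ d)) = contradiction (∣[x+a]-x⇒∣a x (ℤ.∣-trans q∣n d)) q∤a
      surjective x (inj₁ (inj₂ d)) = ∣x-x₀ x n-odd ℤ.∣-refl d
      surjective x (inj₂ (_ , inj₁ d)) = contradiction (∣[x+a]-x⇒∣a x d) q∤a
      surjective x (inj₂ (p∤x , inj₂ d)) = contradiction
        (∣-halve p-odd (∣-combination 1ℤ -1ℤ (ℤ.∣-trans p∣q d) p∣a (lemma x a))) p∤x
        where
        lemma : ∀ x a → x + x ≡ 1ℤ * ((x + a) + x) + -1ℤ * a
        lemma = solve-∀

    -- The solutions are those of `2x ≡ -a` modulo `q`, namely the `p` lifts `x₀ + q t`. They are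
    -- prime to `p`, since `p ∣ x` would imply `p ∣ a`.
    count-p∤a : ¬ (+ p ∣ a) → HasCardinality Coincidences p
    count-p∤a p∤a = count (↔-id _) e e-∼
      (λ i j d → digit-unique q p (trans n≡p*q (ℕ.*-comm p q)) x₀ d) e-surjective
      where
      e : Fin p → ℤ
      e t = x₀ + + q * + toℕ t

      q∤a : ¬ (+ q ∣ a)
      q∤a = p∤a ∘ ℤ.∣-trans p∣q

      e-∼ : ∀ t → e t + a ∼ e t
      e-∼ t = inj₂ (p∤e , inj₂ q∣2e+a)
        where
        q∣2e+a : + q ∣ (e t + a) + e t
        q∣2e+a = ∣[x+a]+x (e t) q∣n (divides (+ toℕ t) (lemma x₀ (+ q) (+ toℕ t)))
          where
          lemma : ∀ x q t → (x + q * t) - x ≡ t * q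
          lemma = solve-∀
        p∤e : ¬ (+ p ∣ e t)
        p∤e p∣e = p∤a (∣-combination 1ℤ (- (1ℤ + 1ℤ)) (ℤ.∣-trans p∣q q∣2e+a) p∣e (lemma (e t) a))
          where
          lemma : ∀ x a → a ≡ 1ℤ * ((x + a) + x) + - (1ℤ + 1ℤ) * x
          lemma = solve-∀

      from-x₀ : ∀ x → + q ∣ (x + a) + x → ∃ λ t → + n ∣ x - e t
      -- `p` and `q` exchange roles: `x` is known modulo `q`, and `t` ranges modulo `p`.
      from-x₀ x d = digit q p (trans n≡p*q (ℕ.*-comm p q)) x x₀ (∣x-x₀ x q-odd q∣n d)

      e-surjective : ∀ x → x + a ∼ x → ∃ λ t → + n ∣ x - e t
      e-surjective x x+a∼x with ∼⇒≡±[q] {x + a} {x} x+a∼x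
      ... | inj₁ d = contradiction (∣[x+a]-x⇒∣a x d) q∤a
      ... | inj₂ d = from-x₀ x d

    zero-difference : ¬ (+ n ∣ a) →
      ∃ λ t → t ∈ (1 ∷ p ∷ (n ℕ.∸ q ℕ.+ 1) ∷ []) × HasCardinality Coincidences t
    zero-difference n∤a = cases (+ q ℤ.∣? a) (+ p ℤ.∣? a)
      where
      size : ℕ.pred p ℕ.* q ℕ.+ 1 ≡ n ℕ.∸ q ℕ.+ 1
      size = cong (ℕ._+ 1) (trans (ℕ.*-distribʳ-∸ q p 1)
        (cong₂ ℕ._∸_ (sym n≡p*q) (ℕ.*-identityˡ q)))

      cases : Dec (+ q ∣ a) → Dec (+ p ∣ a) →
        ∃ λ t → t ∈ (1 ∷ p ∷ (n ℕ.∸ q ℕ.+ 1) ∷ []) × HasCardinality Coincidences t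
      cases (yes q∣a) _         =
        ℕ.pred p ℕ.* q ℕ.+ 1 , there (there (here size)) , count-q∣a q∣a n∤a
      cases (no q∤a)  (yes p∣a) = 1 , here refl , count-p∣a q∤a p∣a
      cases (no _)    (no p∤a)  = p , there (here refl) , count-p∤a p∤a

  -- Cardinalities and the zero-difference property

  domain-cardinality : HasCardinality (AbelianGroup.setoid (ℤ/⁺ n)) n
  domain-cardinality = enumerate (↔-id _) (λ i → + toℕ i) (residue-unique ∘ n∣x-y)
    (λ x → let i , d = residue n x in i , mod-sym {x} {+ toℕ i} (mod d))

  -- Twice the left side is `(q + 1) + (p - 1) r`, which is `2q - r + 1` because `p r = q`; the
  -- division is thus exact.
  image-size : suc M ℕ.+ m ℕ.* r ≡ (2 ℕ.* q ℕ.∸ r ℕ.+ 1) ℕ./ 2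
  image-size = sym (trans (cong (ℕ._/ 2) numerator) (ℕ.m*n/n≡m (suc M ℕ.+ m ℕ.* r) 2))
    where
    lemma : ∀ q m r → q ℕ.+ suc (m ℕ.+ m) ℕ.* r ≡ (q ℕ.+ (m ℕ.+ m) ℕ.* r) ℕ.+ r
    lemma = ℕ-Solver.solve-∀
    lemma′ : ∀ M m r → suc (M ℕ.+ M) ℕ.+ (m ℕ.+ m) ℕ.* r ℕ.+ 1 ≡ (suc M ℕ.+ m ℕ.* r) ℕ.* 2
    lemma′ = ℕ-Solver.solve-∀
    2q≡ : 2 ℕ.* q ≡ (q ℕ.+ (m ℕ.+ m) ℕ.* r) ℕ.+ r
    2q≡ = trans (cong (q ℕ.+_) (trans (ℕ.+-identityʳ q) (trans q≡p*r
      (cong (ℕ._* r) (proj₂ p-odd))))) (lemma q m r)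
    numerator : 2 ℕ.* q ℕ.∸ r ℕ.+ 1 ≡ (suc M ℕ.+ m ℕ.* r) ℕ.* 2
    numerator = trans (cong (λ x → x ℕ.∸ r ℕ.+ 1) 2q≡)
      (trans (cong (ℕ._+ 1) (ℕ.m+n∸n≡m (q ℕ.+ (m ℕ.+ m) ℕ.* r) r))
      (trans (cong (λ q → q ℕ.+ (m ℕ.+ m) ℕ.* r ℕ.+ 1) (proj₂ q-odd)) (lemma′ M m r)))

  module _ (G : Subgroup (ℤ/ n ˣ) 0ℓ)
    (g : Group.Carrier (ℤ/ n ˣ)) (g≡ : proj₁ g ≡ + q - 1ℤ) (g∈G : Subgroup.Member G g)
    (G⊆±1 : ∀ {u} → Subgroup.Member G u → Subgroup.Member ±1 u) where
    open UnitSubgroup G g g≡ g∈G G⊆±1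

    -- Injectivity of `h` makes equal indices mean equal cosets, that is `∼`. The representatives
    -- then enumerate the image, and the counts of coincidences transfer.
    cosetIndex-isZeroDifference :
      ∀ d → HasCardinality (Cosets G) d →
      (h : Bijection (Cosets G) (CommutativeRing.setoid (ℤ/ d))) →
      IsZeroDifference (ℤ/⁺ n) (ℤ/⁺ d) (cosetIndex G h) n ((2 ℕ.* q ℕ.∸ r ℕ.+ 1) ℕ./ 2)
        (_∈ (1 ∷ p ∷ (n ℕ.∸ q ℕ.+ 1) ∷ []))
    cosetIndex-isZeroDifference d ∣Cosets∣ h = record
      { domain-cardinality = domain-cardinality
      -- ℤ/d is counted through the inverse of `h`, which leads back to the cosets.
      ; codomain-finite    = d , Bijection-trans (Bijection-sym h from-cong) ∣Cosets∣
      ; image-cardinality  = subst (HasCardinality (Image (cosetIndex G h))) image-size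
          (enumerate (↔-trans Fin.+↔⊎ (↔-id _ ⊎-↔ Fin.*↔×))
            (λ u → index.to (representative u) , representative u , h.Eq₂.refl)
            (λ {u} {v} eq → representative-injective u v (f≈⇒∼ eq))
            (λ (y , x , fx≈y) → let u , u∼x = representative-surjective x in
              u , h.Eq₂.trans (∼⇒f≈ u∼x) fx≈y))
      ; zero-difference    = λ a a≉0 →
          let t , t∈S , ∣Coincidences∣ = zero-difference a
                (λ n∣a → a≉0 (mod (subst (+ n ∣_) (sym (ℤ.+-identityʳ a)) n∣a)))
          in t , t∈S , Subset-cardinality
               {S = AbelianGroup.setoid (ℤ/⁺ n)}
               {P = λ x → x + a ∼ x} {Q = λ x → h.Eq₂._≈_ (index.to (x + a)) (index.to x)}
               (λ _ → ∼⇒f≈) (λ _ → f≈⇒∼) ∣Coincidences∣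
      }
      where
      module h = Bijection h
      module Cosets = Setoid (Cosets G)
      module index = Func (cosetIndex G h)

      from-cong : ∀ {y z} → h.Eq₂._≈_ y z → h.to⁻ y Cosets.≈ h.to⁻ z
      from-cong {y} {z} y≈z = h.injective (h.Eq₂.trans (proj₂ (h.strictlySurjective y))
        (h.Eq₂.trans y≈z (h.Eq₂.sym (proj₂ (h.strictlySurjective z)))))

      f≈⇒∼ : ∀ {x y} → h.Eq₂._≈_ (index.to x) (index.to y) → x ∼ y
      f≈⇒∼ {x} {y} eq = ∈coset⇒∼ (proj₁ (h.injective eq) (∈-coset G x))

      ∼⇒f≈ : ∀ {x y} → x ∼ y → h.Eq₂._≈_ (index.to x) (index.to y)
      ∼⇒f≈ {x} {y} x∼y = h.Eq₂.sym (h.cong (coset-unique G y x (∼⇒∈coset x∼y)))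

-- Specialisation to prime powers

open import Data.Nat.Base using (_+_; _*_; _∸_; _^_; _/_; _<_)
open import Data.Nat.Divisibility using (_∣_)
open import Data.Nat.Primality using (Prime)

theorem3p6 : (p k : ℕ) → Prime p → ¬ (2 ∣ p) → (2<k : 2 < k) →
    let G = ⟨ p^[k-1]-1 p k 2<k ⟩ in
    (d : ℕ) → HasCardinality (Cosets G) d →
    (h : Bijection (Cosets G) (CommutativeRing.setoid (ℤ/ d))) →
    IsZeroDifference (ℤ/⁺ (p ^ k)) (ℤ/⁺ d) (cosetIndex G h)
    (p ^ k)
    ((2 * p ^ (k ∸ 1) ∸ p ^ (k ∸ 2) + 1) / 2)
    (_∈ (1 ∷ p ∷ (p ^ k ∸ p ^ (k ∸ 1) + 1) ∷ []))
theorem3p6 p k@(suc (suc i)) p-prime ¬2∣p 2<k =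
  let g = p^[k-1]-1 p k 2<k in
  let G = ⟨ g ⟩ in
  cosetIndex-isZeroDifference G g refl generator
    -- `q - 1` lies in `±1`, hence so does all that it generates.
    (generated-induction ±1.Member (≡q-1⇒∈±1 g refl)
      (λ {u} {v} → ±1.resp {u} {v}) ±1.ε-closed
      (λ {u} {v} → ±1.∙-closed {u} {v}) (λ {u} → ±1.⁻¹-closed {u}))
  where
  -- With `k` matched as `suc (suc i)`, both `q = p r` and `n = p q` hold by computation.
  open SquareFactor p (p ^ (k ∸ 1)) (p ^ (k ∸ 2)) (p ^ k) refl refl p-prime
    (¬2∣⇒odd ¬2∣p) (odd-^ (k ∸ 2) (¬2∣⇒odd ¬2∣p))
  module ±1 = Subgroup ±1
theorem3p6 p 1 _ _ (ℕ.s≤s ())
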